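{- Every $6$-regular graph with at least $14$ vertices has an internal partition.
   Context: Graphs are finite and simple. For $S\subseteq V$ and $v\in V$, $d_S(v)$ is the number of neighbors of $v$ in $S$, and $d(v)$ is the degree of $v$. An internal partition of $G=(V,E)$ is a partition $V=A\dot\cup B$ with $A,B\neq\emptyset$ such that $d_A(x)\ge d(x)/2$ for every $x\in A$ and $d_B(y)\ge d(y)/2$ for every $y\in B$. -}

module Defs where

open import Data.Nat using (ℕ; _*_; _≥_)
open import Data.Bool using (Bool; true; false; _∧_; not; T?)
open import Data.Fin using (Fin)
open import Data.List using (List; filter; length; allFin)
open import Data.Product using (_×_; ∃)
open import Relation.Binary.PropositionalEquality using (_≡_)
open import Relation.Nullary.Decidable using (does)
open import Relation.Nullary using (¬_)

record SimpleGraph (n : ℕ) : Set where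
  field
    adj   : Fin n → Fin n → Bool
    sym   : ∀ u v → adj u v ≡ adj v u
    loopless : ∀ v → adj v v ≡ false
open SimpleGraph public

VSubset : ℕ → Set
VSubset n = Fin n → Bool

degIn : ∀ {n} → SimpleGraph n → VSubset n → Fin n → ℕ
degIn {n} G S v = length (filter (λ u → T? (adj G v u ∧ S u)) (allFin n))

deg : ∀ {n} → SimpleGraph n → Fin n → ℕ
deg G v = degIn G (λ _ → true) v

Regular : ∀ {n} → ℕ → SimpleGraph n → Set
Regular k G = ∀ v → deg G v ≡ k

compl : ∀ {n} → VSubset n → VSubset n
compl S v = not (S v)

-- An internal partition V = A ∪̇ B, with A given by the characteristic
-- function A and B its complement: both parts nonempty and every vertex
-- has at least half of its neighbours in its own part
-- (d_A(x) ≥ d(x)/2 written as 2·d_A(x) ≥ d(x)).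
IsInternalPartition : ∀ {n} → SimpleGraph n → VSubset n → Set
IsInternalPartition {n} G A =
    (∃ λ (x : Fin n) → A x ≡ true)
  × (∃ λ (y : Fin n) → A y ≡ false)
  × (∀ x → A x ≡ true  → 2 * degIn G A x ≥ deg G x)
  × (∀ y → A y ≡ false → 2 * degIn G (compl A) y ≥ deg G y)

HasInternalPartition : ∀ {n} → SimpleGraph n → Set
HasInternalPartition {n} G = ∃ λ (A : VSubset n) → IsInternalPartition G A

{-# OPTIONS --safe #-}
module Submission where

-- Among the sets of ⌈n/2⌉ vertices take S maximizing the number of edges
-- inside S, and let B be its complement. If the graph has no internal
-- partition, some part has a vertex y with at most 2 neighbours in its own
-- part. Optimality under swaps makes the other part 3-cohesive (minimum
-- inner degree ≥ 3) and dense; y's own part then contains no 3-cohesive set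
-- (two disjoint ones extend to an internal partition), so it is 2-degenerate
-- and spans at most 2k − 3 edges on k vertices. Comparing edge counts, y's
-- part is strictly smaller, so it is B, ∣S∣ = ∣B∣ + 1, and all estimates are
-- equalities: y has exactly 2 neighbours in B, and d_S(x) + [x ∼ y] = 4 for
-- all x ∈ S, so exchanging y with any x ∈ S preserves optimality. Let z have
-- at most 2 neighbours in B − y. Applying the equalities after each exchange
-- shows that every x ∈ S not adjacent to z has the same neighbours as z in
-- S − x + y. There are so many such x (as ∣S∣ ≥ 8) that some common neighbour
-- has too large a degree in S.

open import Defs hiding (sym)
open import Data.Nat using (ℕ; _≥_; zero; suc; _+_; _*_; _∸_; _≤_; _<_; z≤n; s≤s; _≤?_; ⌊_/2⌋; ⌈_/2⌉)
open import Data.Nat.Properties hiding (_≟_)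
open import Data.Nat.Tactic.RingSolver using (solve-∀)
open import Data.Bool using (Bool; true; false; _∧_; _∨_; not; T?) renaming (_≟_ to _≟ᵇ_)
open import Data.Bool.Properties using (not-injective; ∨-identityʳ; ∧-identityʳ)
open import Data.Fin using (Fin; zero; suc; _≟_)
open import Data.Fin.Properties using (any?; all?)
open import Data.Fin.Subset.Properties using (anySubset?)
open import Data.List using (filter; length; tabulate)
import Data.Vec as Vec
open import Data.Vec.Properties using (lookup∘tabulate)
open import Data.Product using (_×_; ∃; _,_; proj₁; proj₂)
open import Data.Sum using (_⊎_; inj₁; inj₂; [_,_]′)
open import Data.Empty using (⊥)
open import Function using (_∘_; id)
open import Relation.Nullary using (¬_; Dec; yes; no; does; contradiction)
open import Relation.Nullary.Decidable using (_×-dec_; _→-dec_; decidable-stable; dec-true; dec-false; map′)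
open import Relation.Binary.PropositionalEquality hiding ([_])
open import Algebra.Properties.CommutativeMonoid.Sum +-0-commutativeMonoid
  using (sum; sum-cong-≗; ∑-distrib-+; ∑-comm)
open import Algebra.Properties.Semiring.Sum +-*-semiring using (*-distribˡ-sum; *-distribʳ-sum)

open ≤-Reasoning

-- Linear arithmetic, finite sums and Boolean indicators.

⌈n/2⌉≤1+⌊n/2⌋ : ∀ n → ⌈ n /2⌉ ≤ suc ⌊ n /2⌋
⌈n/2⌉≤1+⌊n/2⌋ n = ⌊n/2⌋-mono (n≤1+n (suc n))

private
  variable
    n : ℕ

-- Pattern for all linear arithmetic below: the hypotheses are added up to `l ≤ r`, and the ring
-- solver checks that both sides exceed the goal by the same `X`.
≤-linear : ∀ {l r L R} X → l ≤ r → l ≡ L + X → r ≡ R + X → L ≤ R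
≤-linear {L = L} {R} X l≤r refl refl = +-cancelʳ-≤ X L R l≤r

sum-mono-≤ : {f g : Fin n → ℕ} → (∀ i → f i ≤ g i) → sum f ≤ sum g
sum-mono-≤ {zero}  f≤g = z≤n
sum-mono-≤ {suc n} f≤g = +-mono-≤ (f≤g zero) (sum-mono-≤ (f≤g ∘ suc))

sum-const-zero : ∀ n → sum {n} (λ _ → 0) ≡ 0
sum-const-zero zero    = refl
sum-const-zero (suc n) = sum-const-zero n

-- Termwise bounds whose totals agree leave no slack in any term. This is how a tight edge count
-- determines the degree of every single vertex.
sum-squeeze : {f g : Fin n → ℕ} → (∀ i → f i ≤ g i) → sum g ≤ sum f → ∀ i → f i ≡ g i
sum-squeeze {suc n} {f} {g} f≤g ∑g≤∑f zero = ≤-antisym (f≤g zero)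
  (+-cancelʳ-≤ (sum (g ∘ suc)) _ _
    (≤-trans ∑g≤∑f (+-monoʳ-≤ (f zero) (sum-mono-≤ (f≤g ∘ suc)))))
sum-squeeze {suc n} {f} {g} f≤g ∑g≤∑f (suc i) = sum-squeeze (f≤g ∘ suc)
  (+-cancelˡ-≤ (g zero) _ _
    (≤-trans ∑g≤∑f (+-monoˡ-≤ (sum (f ∘ suc)) (f≤g zero)))) i

sum-positive : (f : Fin n → ℕ) → 1 ≤ sum f → ∃ λ i → 1 ≤ f i
sum-positive {suc n} f 1≤ with f zero in eq
... | suc k = zero , subst (1 ≤_) (sym eq) (s≤s z≤n)
... | zero  = let i , 1≤fi = sum-positive (f ∘ suc) 1≤ in suc i , 1≤fi

⟦_⟧ : Bool → ℕ
⟦ true ⟧  = 1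
⟦ false ⟧ = 0

⟦⟧-cases : ∀ b → ⟦ b ⟧ ≡ 0 ⊎ ⟦ b ⟧ ≡ 1
⟦⟧-cases true  = inj₂ refl
⟦⟧-cases false = inj₁ refl

⟦⟧≤1 : ∀ b → ⟦ b ⟧ ≤ 1
⟦⟧≤1 true  = s≤s z≤n
⟦⟧≤1 false = z≤n

⟦∧⟧ : ∀ a b → ⟦ a ∧ b ⟧ ≡ ⟦ a ⟧ * ⟦ b ⟧
⟦∧⟧ true  b = sym (+-identityʳ ⟦ b ⟧)
⟦∧⟧ false b = refl

⟦⟧≥1⇒true : ∀ {b} → 1 ≤ ⟦ b ⟧ → b ≡ true
⟦⟧≥1⇒true {true} _ = refl

⟦⟧*⟦⟧≥1⇒true : ∀ {a b} → 1 ≤ ⟦ a ⟧ * ⟦ b ⟧ → a ≡ true × b ≡ true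
⟦⟧*⟦⟧≥1⇒true {true} {true} _ = refl , refl

⟦⟧-*-mono : ∀ b {m k} → (b ≡ true → m ≤ k) → ⟦ b ⟧ * m ≤ ⟦ b ⟧ * k
⟦⟧-*-mono true  m≤k = *-monoʳ-≤ 1 (m≤k refl)
⟦⟧-*-mono false m≤k = z≤n

true≢false : true ≢ false
true≢false ()

-- Vertex sets are handled through their characteristic functions
-- Fin n → ℕ, so that degrees and edge counts become additive.

χ : VSubset n → Fin n → ℕ
χ S v = ⟦ S v ⟧

δ : Fin n → Fin n → ℕ
δ x u = ⟦ does (x ≟ u) ⟧

infixl 6 _⊕_
_⊕_ : (f g : Fin n → ℕ) → Fin n → ℕ
(f ⊕ g) v = f v + g v

size : VSubset n → ℕ
size S = sum (χ S)

sum-δ : (x : Fin n) (f : Fin n → ℕ) → sum (λ u → δ x u * f u) ≡ f x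
sum-δ {suc n} zero f = begin-equality
  f zero + 0 + sum {n} (λ _ → 0)  ≡⟨ cong₂ _+_ (+-identityʳ (f zero)) (sum-const-zero n) ⟩
  f zero + 0                      ≡⟨ +-identityʳ (f zero) ⟩
  f zero                          ∎
sum-δ {suc n} (suc x) f = sum-δ x (f ∘ suc)

size-δ : (x : Fin n) → sum (δ x) ≡ 1
size-δ x = trans (sum-cong-≗ (λ u → sym (*-identityʳ (δ x u)))) (sum-δ x (λ _ → 1))

δ-refl : (x : Fin n) → δ x x ≡ 1
δ-refl x = cong ⟦_⟧ (dec-true (x ≟ x) refl)

δ-≢ : {x u : Fin n} → x ≢ u → δ x u ≡ 0
δ-≢ {x = x} {u} x≢u = cong ⟦_⟧ (dec-false (x ≟ u) x≢u)

χ-true : (S : VSubset n) {v : Fin n} → S v ≡ true → χ S v ≡ 1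
χ-true S Sv = cong ⟦_⟧ Sv

insert remove : VSubset n → Fin n → VSubset n
insert S x u = S u ∨ does (x ≟ u)
remove S x u = S u ∧ not (does (x ≟ u))

χ-insert : (S : VSubset n) {x : Fin n} → S x ≡ false → χ (insert S x) ≗ χ S ⊕ δ x
χ-insert S {x} x∉S u with x ≟ u
... | yes refl rewrite x∉S = refl
... | no _ rewrite ∨-identityʳ (S u) = sym (+-identityʳ _)

χ-remove : (S : VSubset n) {x : Fin n} → S x ≡ true → χ (remove S x) ⊕ δ x ≗ χ S
χ-remove S {x} x∈S u with x ≟ u
... | yes refl rewrite x∈S = refl
... | no _ rewrite ∧-identityʳ (S u) = +-identityʳ _

size-cong-⊕δ : {f g : Fin n → ℕ} (x : Fin n) → f ≗ g ⊕ δ x → sum f ≡ suc (sum g)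
size-cong-⊕δ {f = f} {g} x f≗ = begin-equality
  sum f              ≡⟨ sum-cong-≗ f≗ ⟩
  sum (g ⊕ δ x)      ≡⟨ ∑-distrib-+ g (δ x) ⟩
  sum g + sum (δ x)  ≡⟨ cong (sum g +_) (size-δ x) ⟩
  sum g + 1          ≡⟨ +-comm (sum g) 1 ⟩
  suc (sum g)        ∎

remove-≢ : (S : VSubset n) (x v : Fin n) → remove S x v ≡ true → x ≢ v
remove-≢ S x _ v∈ refl with S x | x ≟ x
remove-≢ S x _ () refl | true | yes _
remove-≢ S x _ v∈ refl | true | no x≢x = x≢x refl

size-insert : (S : VSubset n) {x : Fin n} → S x ≡ false → size (insert S x) ≡ suc (size S)
size-insert S {x} x∉S = size-cong-⊕δ x (χ-insert S x∉S)

size-remove : (S : VSubset n) {x : Fin n} → S x ≡ true → size S ≡ suc (size (remove S x))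
size-remove S {x} x∈S = size-cong-⊕δ x (sym ∘ χ-remove S x∈S)

∈-nonempty : (S : VSubset n) {v : Fin n} → S v ≡ true → 1 ≤ size S
∈-nonempty S {v} Sv = subst (1 ≤_) (sym (size-remove S Sv)) (s≤s z≤n)

nonempty-∈ : (S : VSubset n) → 1 ≤ size S → ∃ λ v → S v ≡ true
nonempty-∈ S 1≤ = let v , 1≤v = sum-positive (χ S) 1≤ in v , ⟦⟧≥1⇒true 1≤v

exists-of-size : ∀ {n} k → k ≤ n → ∃ λ (S : VSubset n) → size S ≡ k
exists-of-size {n} zero k≤n = (λ _ → false) , sum-const-zero n
exists-of-size (suc k) (s≤s k≤n) with exists-of-size k k≤n
... | S , ∣S∣≡k = (λ { zero → true ; (suc i) → S i }) , cong suc ∣S∣≡k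

compl-⊕ : (S : VSubset n) → χ S ⊕ χ (compl S) ≗ λ _ → 1
compl-⊕ S v with S v
... | true  = refl
... | false = refl

sum-const-one : ∀ n → sum {n} (λ _ → 1) ≡ n
sum-const-one zero    = refl
sum-const-one (suc n) = cong suc (sum-const-one n)

-- The function `f` is general because `allFin n` is `tabulate id` and the induction passes to
-- `f ∘ suc`.
length-filter-tabulate : ∀ {m} (p : Fin m → Bool) (f : Fin n → Fin m) →
  length (filter (λ u → T? (p u)) (tabulate f)) ≡ sum (λ i → ⟦ p (f i) ⟧)
length-filter-tabulate {zero}  p f = refl
length-filter-tabulate {suc n} p f with p (f zero)
... | true  = cong suc (length-filter-tabulate p (f ∘ suc))
... | false = length-filter-tabulate p (f ∘ suc)

-- Degrees and edge counts in an arbitrary graph.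

module Degrees {n} (G : SimpleGraph n) where

  a : Fin n → Fin n → ℕ
  a u v = ⟦ adj G u v ⟧

  a-sym : ∀ u v → a u v ≡ a v u
  a-sym u v = cong ⟦_⟧ (SimpleGraph.sym G u v)

  a-irrefl : ∀ v → a v v ≡ 0
  a-irrefl v = cong ⟦_⟧ (loopless G v)

  d : (Fin n → ℕ) → Fin n → ℕ
  d f v = sum (λ u → a v u * f u)

  e : (f g : Fin n → ℕ) → ℕ
  e f g = sum (λ v → f v * d g v)

  -- For a characteristic function this is twice the number of edges inside the set, each edge being
  -- counted from both ends.
  vol : (Fin n → ℕ) → ℕ
  vol f = e f f

  degIn≡d : ∀ S v → degIn G S v ≡ d (χ S) v
  degIn≡d S v = trans (length-filter-tabulate (λ u → adj G v u ∧ S u) id)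
    (sum-cong-≗ (λ u → ⟦∧⟧ (adj G v u) (S u)))

  d-cong : ∀ {f g} → f ≗ g → d f ≗ d g
  d-cong f≗g v = sum-cong-≗ (λ u → cong (a v u *_) (f≗g u))

  d-⊕ : ∀ f g → d (f ⊕ g) ≗ d f ⊕ d g
  d-⊕ f g v = trans (sum-cong-≗ (λ u → *-distribˡ-+ (a v u) (f u) (g u)))
    (∑-distrib-+ (λ u → a v u * f u) (λ u → a v u * g u))

  d-δ : ∀ x v → d (δ x) v ≡ a v x
  d-δ x v = trans (sum-cong-≗ (λ u → *-comm (a v u) (δ x u))) (sum-δ x (a v))

  d-⊕δ : ∀ f x v → d (f ⊕ δ x) v ≡ d f v + a v x
  d-⊕δ f x v = trans (d-⊕ f (δ x) v) (cong (d f v +_) (d-δ x v))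

  e-sym : ∀ f g → e f g ≡ e g f
  e-sym f g = begin-equality
    sum (λ v → f v * sum (λ u → a v u * g u))      ≡⟨ sum-cong-≗ (λ v → *-distribˡ-sum (f v) (λ u → a v u * g u)) ⟩
    sum (λ v → sum (λ u → f v * (a v u * g u)))    ≡⟨ ∑-comm (λ v u → f v * (a v u * g u)) ⟩
    sum (λ u → sum (λ v → f v * (a v u * g u)))    ≡⟨ sum-cong-≗ (λ u → sum-cong-≗ (λ v →
        trans (cong (λ □ → f v * (□ * g u)) (a-sym v u)) (rearrange (f v) (a u v) (g u)))) ⟩
    sum (λ u → sum (λ v → g u * (a u v * f v)))    ≡⟨ sum-cong-≗ (λ u → sym (*-distribˡ-sum (g u) (λ v → a u v * f v))) ⟩
    sum (λ u → g u * sum (λ v → a u v * f v))      ∎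
    where
    rearrange : ∀ p q r → p * (q * r) ≡ r * (q * p)
    rearrange = solve-∀

  e-⊕ˡ : ∀ f g h → e (f ⊕ g) h ≡ e f h + e g h
  e-⊕ˡ f g h = trans (sum-cong-≗ (λ v → *-distribʳ-+ (d h v) (f v) (g v)))
    (∑-distrib-+ (λ v → f v * d h v) (λ v → g v * d h v))

  e-⊕ʳ : ∀ f g h → e f (g ⊕ h) ≡ e f g + e f h
  e-⊕ʳ f g h = trans (e-sym f (g ⊕ h)) (trans (e-⊕ˡ g h f) (cong₂ _+_ (e-sym g f) (e-sym h f)))

  e-cong : ∀ {f f′ g g′} → f ≗ f′ → g ≗ g′ → e f g ≡ e f′ g′
  e-cong f≗ g≗ = sum-cong-≗ (λ v → cong₂ _*_ (f≗ v) (d-cong g≗ v))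

  vol-⊕δ : ∀ f x → vol (f ⊕ δ x) ≡ vol f + 2 * d f x
  vol-⊕δ f x = begin-equality
    e (f ⊕ δ x) (f ⊕ δ x)                            ≡⟨ e-⊕ˡ f (δ x) (f ⊕ δ x) ⟩
    e f (f ⊕ δ x) + e (δ x) (f ⊕ δ x)                ≡⟨ cong₂ _+_ (e-⊕ʳ f f (δ x)) (sum-δ x (d (f ⊕ δ x))) ⟩
    vol f + e f (δ x) + d (f ⊕ δ x) x                ≡⟨ cong₂ (λ p q → vol f + p + q) (trans (e-sym f (δ x)) (sum-δ x (d f)))
                                                          (trans (d-⊕δ f x x) (cong (d f x +_) (a-irrefl x))) ⟩
    vol f + d f x + (d f x + 0)                      ≡⟨ +-assoc (vol f) (d f x) (d f x + 0) ⟩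
    vol f + 2 * d f x                                ∎

  -- The bound 3 is half of the degree 6, so this is the condition that an internal partition puts
  -- on one part.
  Cohesive : VSubset n → Set
  Cohesive S = ∀ v → S v ≡ true → 3 ≤ d (χ S) v

  d≤size : ∀ S v → d (χ S) v ≤ size S
  d≤size S v = sum-mono-≤ (λ u → ≤-trans (*-monoˡ-≤ (χ S u) (⟦⟧≤1 (adj G v u))) (≤-reflexive (*-identityˡ (χ S u))))

  d-mono : ∀ {S T} → (∀ v → S v ≡ true → T v ≡ true) → ∀ v → d (χ S) v ≤ d (χ T) v
  d-mono {S} {T} S⊆T v = sum-mono-≤ (λ u → *-monoʳ-≤ (a v u) (χ-mono u))
    where
    χ-mono : ∀ u → χ S u ≤ χ T u
    χ-mono u with S u in Su
    ... | true  = ≤-reflexive (sym (χ-true T (S⊆T u Su)))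
    ... | false = z≤n

  LowDegreeVertex : VSubset n → Set
  LowDegreeVertex S = ∃ λ v → S v ≡ true × d (χ S) v ≤ 2

  lowDegreeVertex? : ∀ S → Dec (LowDegreeVertex S)
  lowDegreeVertex? S = any? (λ v → (S v ≟ᵇ true) ×-dec (d (χ S) v ≤? 2))

  ¬low⇒cohesive : ∀ S → ¬ LowDegreeVertex S → Cohesive S
  ¬low⇒cohesive S ¬low v Sv = ≰⇒> (λ d≤2 → ¬low (v , Sv , d≤2))

  -- 2-degeneracy, phrased through all nonempty subsets rather than an elimination order; it then
  -- passes to subsets at once, and its failure yields a nonempty cohesive set.
  Degenerate : VSubset n → Set
  Degenerate S = ∀ T → (∀ v → T v ≡ true → S v ≡ true) → 1 ≤ size T → LowDegreeVertex T

  remove⊆ : ∀ (S : VSubset n) x v → remove S x v ≡ true → S v ≡ true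
  remove⊆ S x v v∈ with S v
  ... | true = refl

  remove-degenerate : ∀ {S x} → Degenerate S → Degenerate (remove S x)
  remove-degenerate {S} {x} deg T T⊆ = deg T (λ v → remove⊆ S x v ∘ T⊆ v)

  d-remove : ∀ S x → S x ≡ true → d (χ (remove S x)) x ≡ d (χ S) x
  d-remove S x x∈S = begin-equality
    d (χ (remove S x)) x            ≡⟨ +-identityʳ _ ⟨
    d (χ (remove S x)) x + 0        ≡⟨ cong (d (χ (remove S x)) x +_) (a-irrefl x) ⟨
    d (χ (remove S x)) x + a x x    ≡⟨ d-⊕δ (χ (remove S x)) x x ⟨
    d (χ (remove S x) ⊕ δ x) x      ≡⟨ d-cong (χ-remove S x∈S) x ⟩
    d (χ S) x                       ∎

  vol-remove : ∀ S x → S x ≡ true → vol (χ S) ≡ vol (χ (remove S x)) + 2 * d (χ (remove S x)) x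
  vol-remove S x x∈S = trans (sym (e-cong (χ-remove S x∈S) (χ-remove S x∈S))) (vol-⊕δ (χ (remove S x)) x)

  vol≤size² : ∀ S → vol (χ S) ≤ size S * size S
  vol≤size² S = begin
    vol (χ S)                    ≤⟨ sum-mono-≤ (λ v → *-monoʳ-≤ (χ S v) (d≤size S v)) ⟩
    sum (λ v → χ S v * size S)   ≡⟨ *-distribʳ-sum (size S) (χ S) ⟨
    size S * size S              ∎

  vol-empty : ∀ S → size S ≡ 0 → vol (χ S) ≡ 0
  vol-empty S ∣S∣≡0 = n≤0⇒n≡0 (subst (λ s → vol (χ S) ≤ s * s) ∣S∣≡0 (vol≤size² S))

  -- Peeling off low vertices loses at most two edges each time, down to two vertices with at most
  -- one edge: at most 2s - 3 edges on s ≥ 2 vertices. The bound is doubled, and the 6 is moved to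
  -- the left to avoid truncated subtraction.
  degenerate⇒vol : ∀ k S → size S ≡ suc (suc k) → Degenerate S → vol (χ S) + 6 ≤ 4 * size S
  degenerate⇒vol k S ∣S∣≡ deg with deg S (λ _ → id) (subst (1 ≤_) (sym ∣S∣≡) (s≤s z≤n))
  degenerate⇒vol zero S ∣S∣≡2 deg | v , v∈S , _ =
    arith (trans (vol-remove S v v∈S) (cong (_+ 2 * d (χ R) v) volR≡0))
      (≤-trans (d≤size R v) (≤-reflexive ∣R∣≡1)) ∣S∣≡2
    where
    R = remove S v
    ∣R∣≡1 : size R ≡ 1
    ∣R∣≡1 = suc-injective (trans (sym (size-remove S v∈S)) ∣S∣≡2)
    volR≡0 : vol (χ R) ≡ 0
    volR≡0 with w , w∈R ← nonempty-∈ R (≤-reflexive (sym ∣R∣≡1)) =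
      let ∣R-w∣≡0 = suc-injective (trans (sym (size-remove R w∈R)) ∣R∣≡1) in
      trans (vol-remove R w w∈R) (cong₂ (λ p q → p + 2 * q) (vol-empty (remove R w) ∣R-w∣≡0)
        (n≤0⇒n≡0 (subst (d (χ (remove R w)) w ≤_) ∣R-w∣≡0 (d≤size (remove R w) w))))
    arith : ∀ {volS dv s} → volS ≡ 2 * dv → dv ≤ 1 → s ≡ 2 → volS + 6 ≤ 4 * s
    arith refl dv≤1 refl = +-monoˡ-≤ 6 (*-monoʳ-≤ 2 dv≤1)
  degenerate⇒vol (suc k) S ∣S∣≡ deg | v , v∈S , dv≤2 =
    arith (vol (χ R)) (d (χ R) v) (size R) (vol-remove S v v∈S) (size-remove S v∈S)
      (subst (_≤ 2) (sym (d-remove S v v∈S)) dv≤2)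
      (degenerate⇒vol k R (suc-injective (trans (sym (size-remove S v∈S)) ∣S∣≡)) (remove-degenerate {S} {v} deg))
    where
    R = remove S v
    arith : ∀ {volS s} volR dv r → volS ≡ volR + 2 * dv → s ≡ suc r → dv ≤ 2 →
            volR + 6 ≤ 4 * r → volS + 6 ≤ 4 * s
    arith volR dv r refl refl dv≤2 ih = ≤-linear 0 (+-mono-≤ ih (*-monoʳ-≤ 2 dv≤2)) (lhs volR dv) (rhs r)
      where
      lhs : ∀ volR dv → volR + 6 + 2 * dv ≡ volR + 2 * dv + 6 + 0
      lhs = solve-∀
      rhs : ∀ r → 4 * r + 2 * 2 ≡ 4 * suc r + 0
      rhs = solve-∀

  -- Complementary sets and the exchange of two vertices.

  record Complementary (A B : VSubset n) : Set where
    constructor complementary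
    field covers : χ A ⊕ χ B ≗ λ _ → 1
  open Complementary public

  compl-complementary : ∀ A → Complementary A (compl A)
  compl-complementary A = complementary (compl-⊕ A)

  size-complementary : ∀ {A B} → Complementary A B → size A + size B ≡ n
  size-complementary {A} {B} A⊎B = begin-equality
    size A + size B       ≡⟨ ∑-distrib-+ (χ A) (χ B) ⟨
    sum (χ A ⊕ χ B)       ≡⟨ sum-cong-≗ (covers A⊎B) ⟩
    sum {n} (λ _ → 1)     ≡⟨ sum-const-one n ⟩
    n                     ∎

  -- The roles of the two parts are exchanged repeatedly, while `compl (compl A)` agrees with `A`
  -- only pointwise; hence a relation between two sets.
  complementary-sym : ∀ {A B} → Complementary A B → Complementary B A
  complementary-sym {A} {B} A⊎B = complementary λ v → trans (+-comm (χ B v) (χ A v)) (covers A⊎B v)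

  ∈⇒∉ : ∀ {A B} → Complementary A B → ∀ {v} → A v ≡ true → B v ≡ false
  ∈⇒∉ {A} {B} A⊎B {v} v∈A with A v | B v | covers A⊎B v
  ... | true | false | _ = refl

  -- S′ = S − x + y
  record Swapped (S S′ : VSubset n) (x y : Fin n) : Set where
    constructor swapped
    field exchange : χ S′ ⊕ δ x ≗ χ S ⊕ δ y
  open Swapped public

  swap-exists : ∀ S {x y} → S x ≡ true → S y ≡ false → ∃ λ S′ → Swapped S S′ x y
  swap-exists S {x} {y} x∈S y∉S = insert (remove S x) y , swapped λ u → begin-equality
      χ (insert (remove S x) y) u + δ x u   ≡⟨ cong (_+ δ x u) (χ-insert (remove S x) y∉R u) ⟩
      χ (remove S x) u + δ y u + δ x u      ≡⟨ rearrange (χ (remove S x) u) (δ y u) (δ x u) ⟩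
      χ (remove S x) u + δ x u + δ y u      ≡⟨ cong (_+ δ y u) (χ-remove S x∈S u) ⟩
      χ S u + δ y u                         ∎
    where
    y∉R : remove S x y ≡ false
    y∉R rewrite y∉S = refl
    rearrange : ∀ p q r → p + q + r ≡ p + r + q
    rearrange = solve-∀

  -- Once `χ S ⊕ χ S′` is added to both sides, the two cover equations reduce the claim to
  -- `exchange sw`.
  swapped-compl : ∀ {S S′ B B′ x y} → Complementary S B → Complementary S′ B′ →
                  Swapped S S′ x y → Swapped B B′ y x
  swapped-compl {S} {S′} {B} {B′} {x} {y} S⊎B S′⊎B′ sw = swapped λ u → +-cancelʳ-≡ (χ S u + χ S′ u) _ _ (begin-equality
    χ B′ u + δ y u + (χ S u + χ S′ u)     ≡⟨ rearrange₁ (χ B′ u) (δ y u) (χ S u) (χ S′ u) ⟩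
    (χ S u + δ y u) + (χ S′ u + χ B′ u)   ≡⟨ cong₂ _+_ (sym (exchange sw u)) (trans (covers S′⊎B′ u) (sym (covers S⊎B u))) ⟩
    (χ S′ u + δ x u) + (χ S u + χ B u)    ≡⟨ rearrange₂ (χ S′ u) (δ x u) (χ S u) (χ B u) ⟩
    χ B u + δ x u + (χ S u + χ S′ u)      ∎)
    where
    rearrange₁ : ∀ p q r s → p + q + (r + s) ≡ (r + q) + (s + p)
    rearrange₁ = solve-∀
    rearrange₂ : ∀ p q r s → (p + q) + (r + s) ≡ s + q + (r + p)
    rearrange₂ = solve-∀

  swapped-∈ : ∀ {S S′ x y u} → Swapped S S′ x y → S u ≡ true → x ≢ u → S′ u ≡ true
  swapped-∈ {S} {S′} {x} {y} {u} sw u∈S x≢u = ⟦⟧≥1⇒true (begin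
    1                 ≡⟨ χ-true S u∈S ⟨
    χ S u             ≤⟨ m≤m+n (χ S u) (δ y u) ⟩
    χ S u + δ y u     ≡⟨ exchange sw u ⟨
    χ S′ u + δ x u    ≡⟨ cong (χ S′ u +_) (δ-≢ x≢u) ⟩
    χ S′ u + 0        ≡⟨ +-identityʳ _ ⟩
    χ S′ u            ∎)

  swapped-new : ∀ {S S′ x y} → Swapped S S′ x y → x ≢ y → S′ y ≡ true
  swapped-new {S} {S′} {x} {y} sw x≢y = ⟦⟧≥1⇒true (begin
    1                 ≡⟨ δ-refl y ⟨
    δ y y             ≤⟨ m≤n+m (δ y y) (χ S y) ⟩
    χ S y + δ y y     ≡⟨ exchange sw y ⟨
    χ S′ y + δ x y    ≡⟨ cong (χ S′ y +_) (δ-≢ x≢y) ⟩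
    χ S′ y + 0        ≡⟨ +-identityʳ _ ⟩
    χ S′ y            ∎)

  swapped-size : ∀ {S S′ x y} → Swapped S S′ x y → size S′ ≡ size S
  swapped-size {S} {S′} {x} {y} sw = suc-injective (trans (sym (size-cong-⊕δ {g = χ S′} x (λ _ → refl)))
    (size-cong-⊕δ y (exchange sw)))

  swapped-d : ∀ {S S′ x y} → Swapped S S′ x y → ∀ v → d (χ S′) v + a v x ≡ d (χ S) v + a v y
  swapped-d {S} {S′} {x} {y} sw v = begin-equality
    d (χ S′) v + a v x    ≡⟨ d-⊕δ (χ S′) x v ⟨
    d (χ S′ ⊕ δ x) v      ≡⟨ d-cong (exchange sw) v ⟩
    d (χ S ⊕ δ y) v       ≡⟨ d-⊕δ (χ S) y v ⟩
    d (χ S) v + a v y     ∎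

  -- Both sides are the volume of `χ S ⊕ δ y`, reached from `S′` by adding `x` and from `S` by
  -- adding `y`.
  swapped-vol : ∀ {S S′ x y} → Swapped S S′ x y →
                vol (χ S′) + 2 * (d (χ S) x + a x y) ≡ vol (χ S) + 2 * d (χ S) y
  swapped-vol {S} {S′} {x} {y} sw = begin-equality
    vol (χ S′) + 2 * (d (χ S) x + a x y)   ≡⟨ cong (λ □ → vol (χ S′) + 2 * □) (swapped-d sw x) ⟨
    vol (χ S′) + 2 * (d (χ S′) x + a x x)  ≡⟨ cong (λ □ → vol (χ S′) + 2 * □) (trans (cong (d (χ S′) x +_) (a-irrefl x)) (+-identityʳ _)) ⟩
    vol (χ S′) + 2 * d (χ S′) x            ≡⟨ vol-⊕δ (χ S′) x ⟨
    vol (χ S′ ⊕ δ x)                       ≡⟨ e-cong (exchange sw) (exchange sw) ⟩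
    vol (χ S ⊕ δ y)                        ≡⟨ vol-⊕δ (χ S) y ⟩
    vol (χ S) + 2 * d (χ S) y              ∎

  -- Exhaustive search over Boolean vectors. It makes the proof by contradiction constructive; a
  -- found or given set is moved between vector and function by pointwise equality.
  hasInternalPartition? : Dec (HasInternalPartition G)
  hasInternalPartition? = map′ (λ (p , ip) → Vec.lookup p , ip)
    (λ (A , ip) → Vec.tabulate A , isInternalPartition-cong (sym ∘ lookup∘tabulate A) ip)
    (anySubset? (λ p → isInternalPartition? (Vec.lookup p)))
    where
    degIn-cong : ∀ {A A′ : VSubset n} → A ≗ A′ → ∀ v → degIn G A v ≡ degIn G A′ v
    degIn-cong {A} {A′} A≗A′ v = begin-equality
      degIn G A v     ≡⟨ degIn≡d A v ⟩
      d (χ A) v       ≡⟨ d-cong (cong ⟦_⟧ ∘ A≗A′) v ⟩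
      d (χ A′) v      ≡⟨ degIn≡d A′ v ⟨
      degIn G A′ v    ∎
    isInternalPartition-cong : ∀ {A A′} → A ≗ A′ → IsInternalPartition G A → IsInternalPartition G A′
    isInternalPartition-cong A≗A′ ((x , x∈A) , (y , y∉A) , A-half , B-half) =
      (x , trans (sym (A≗A′ x)) x∈A) , (y , trans (sym (A≗A′ y)) y∉A) ,
      (λ v v∈ → subst (λ □ → 2 * □ ≥ deg G v) (degIn-cong A≗A′ v) (A-half v (trans (A≗A′ v) v∈))) ,
      (λ v v∉ → subst (λ □ → 2 * □ ≥ deg G v) (degIn-cong (cong not ∘ A≗A′) v) (B-half v (trans (A≗A′ v) v∉)))
    isInternalPartition? : ∀ A → Dec (IsInternalPartition G A)
    isInternalPartition? A = any? (λ x → A x ≟ᵇ true) ×-dec any? (λ y → A y ≟ᵇ false)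
      ×-dec all? (λ x → (A x ≟ᵇ true) →-dec (deg G x ≤? 2 * degIn G A x))
      ×-dec all? (λ y → (A y ≟ᵇ false) →-dec (deg G y ≤? 2 * degIn G (compl A) y))

-- Cohesive sets and optimality under exchanges in 6-regular graphs.

module SixRegular {n} (G : SimpleGraph n) (regular : Regular 6 G) where

  open Degrees G

  d-split : ∀ {A B} → Complementary A B → ∀ v → d (χ A) v + d (χ B) v ≡ 6
  d-split {A} {B} A⊎B v = begin-equality
    d (χ A) v + d (χ B) v  ≡⟨ d-⊕ (χ A) (χ B) v ⟨
    d (χ A ⊕ χ B) v        ≡⟨ d-cong (covers A⊎B) v ⟩
    d (λ _ → 1) v          ≡⟨ degIn≡d (λ _ → true) v ⟨
    deg G v                ≡⟨ regular v ⟩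
    6                      ∎

  size*6 : ∀ {A B} → Complementary A B → size A * 6 ≡ vol (χ A) + e (χ A) (χ B)
  size*6 {A} {B} A⊎B = begin-equality
    size A * 6                                    ≡⟨ *-distribʳ-sum 6 (χ A) ⟩
    sum (λ v → χ A v * 6)                         ≡⟨ sum-cong-≗ (λ v → cong (χ A v *_)
      (trans (sym (d-split A⊎B v)) (sym (d-⊕ (χ A) (χ B) v)))) ⟩
    e (χ A) (χ A ⊕ χ B)                           ≡⟨ e-⊕ʳ (χ A) (χ A) (χ B) ⟩
    vol (χ A) + e (χ A) (χ B)                     ∎

  -- Both parts see the same crossing edges: 6∣A∣ - vol A = e(A, B) = 6∣B∣ - vol B.
  vol-compl : ∀ {A B} → Complementary A B → vol (χ A) + size B * 6 ≡ vol (χ B) + size A * 6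
  vol-compl {A} {B} A⊎B = begin-equality
    vol (χ A) + size B * 6                        ≡⟨ cong (vol (χ A) +_) (size*6 (complementary-sym A⊎B)) ⟩
    vol (χ A) + (vol (χ B) + e (χ B) (χ A))       ≡⟨ cong (λ □ → vol (χ A) + (vol (χ B) + □)) (e-sym (χ B) (χ A)) ⟩
    vol (χ A) + (vol (χ B) + e (χ A) (χ B))       ≡⟨ rearrange (vol (χ A)) (vol (χ B)) (e (χ A) (χ B)) ⟩
    vol (χ B) + (vol (χ A) + e (χ A) (χ B))       ≡⟨ cong (vol (χ B) +_) (size*6 A⊎B) ⟨
    vol (χ B) + size A * 6                        ∎
    where
    rearrange : ∀ p q r → p + (q + r) ≡ q + (p + r)
    rearrange = solve-∀

  cohesive-partition : ∀ A → (∃ λ x → A x ≡ true) → (∃ λ y → A y ≡ false) →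
                       Cohesive A → Cohesive (compl A) → IsInternalPartition G A
  cohesive-partition A A≠∅ B≠∅ cohA cohB = A≠∅ , B≠∅ , half A cohA ,
    (λ y y∉A → half (compl A) cohB y (cong not y∉A))
    where
    half : ∀ S → Cohesive S → ∀ v → S v ≡ true → 2 * degIn G S v ≥ deg G v
    half S cohS v v∈S = subst₂ (λ p q → 2 * p ≥ q) (sym (degIn≡d S v)) (sym (regular v)) (*-monoʳ-≤ 2 (cohS v v∈S))

  insert-cohesive : ∀ {A v} → Cohesive A → 3 ≤ d (χ A) v → Cohesive (insert A v)
  insert-cohesive {A} {v} cohA 3≤dv u u∈ = ≤-trans 3≤du (d-mono {A} {insert A v} (λ w w∈A → cong (_∨ _) w∈A) u)
    where
    3≤du : 3 ≤ d (χ A) u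
    3≤du with A u in Au | v ≟ u
    ... | true  | _        = cohA u Au
    ... | false | yes refl = 3≤dv
    3≤du | false | no _ = contradiction u∈ λ ()

  -- Vertices with at least four neighbours in A are moved into A; such a
  -- vertex is never in the cohesive set T, so the process leaves T outside.
  disjoint-cohesive⇒partition : ∀ k A T → n ≤ size A + k → Cohesive A → Cohesive T →
    (∀ v → T v ≡ true → A v ≡ false) → (∃ λ x → A x ≡ true) → (∃ λ y → T y ≡ true) →
    HasInternalPartition G
  -- The number `k` bounds how many vertices lie outside `A`. At zero none would, but `y` does.
  disjoint-cohesive⇒partition zero A T n≤ _ _ disj _ (y , y∈T) = contradiction n≤ (<⇒≱ (begin-strict
    size A + 0                ≡⟨ +-identityʳ _ ⟩
    size A                    <⟨ m<m+n (size A) (∈-nonempty (compl A) (cong not (disj y y∈T))) ⟩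
    size A + size (compl A)   ≡⟨ size-complementary (compl-complementary A) ⟩
    n                         ∎))
  disjoint-cohesive⇒partition (suc k) A T n≤ cohA cohT disj (x , x∈A) (y , y∈T)
    with any? (λ v → (A v ≟ᵇ false) ×-dec (4 ≤? d (χ A) v))
  ... | yes (v , v∉A , 4≤dv) = disjoint-cohesive⇒partition k (insert A v) T
        (subst (n ≤_) (trans (+-suc (size A) k) (cong (_+ k) (sym (size-insert A v∉A)))) n≤)
        (insert-cohesive {A} cohA (≤-trans (n≤1+n 3) 4≤dv)) cohT disj′ (x , cong (_∨ _) x∈A) (y , y∈T)
    where
    disj′ : ∀ u → T u ≡ true → insert A v u ≡ false
    disj′ u u∈T with v ≟ u
    ... | no _ = trans (∨-identityʳ (A u)) (disj u u∈T)
    ... | yes refl = contradiction (begin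
      7                              ≤⟨ +-mono-≤ 4≤dv (cohT v u∈T) ⟩
      d (χ A) v + d (χ T) v          ≤⟨ +-monoʳ-≤ (d (χ A) v) (d-mono {T} {compl A} (λ w w∈T → cong not (disj w w∈T)) v) ⟩
      d (χ A) v + d (χ (compl A)) v  ≡⟨ d-split (compl-complementary A) v ⟩
      6                              ∎) 1+n≰n
  -- Every vertex outside `A` now has at most 3 of its 6 neighbours in `A`, so the complement is
  -- cohesive.
  ... | no none = A , cohesive-partition A (x , x∈A) (y , disj y y∈T) cohA λ v v∉A →
        +-cancelˡ-≤ 3 _ _ (begin
          6                              ≡⟨ d-split (compl-complementary A) v ⟨
          d (χ A) v + d (χ (compl A)) v  ≤⟨ +-monoˡ-≤ _ (≤-pred (≰⇒> (λ 4≤ → none (v , not-injective v∉A , 4≤)))) ⟩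
          3 + d (χ (compl A)) v          ∎)

  -- Exchanging `x` and `y` adds no edge to `A` when d_A(y) ≤ d_A(x) + [x ∼ y]. Writing d_A(y) as 6
  -- - d_B(y) makes the condition symmetric in the two parts.
  SwapStable : (A B : VSubset n) → Set
  SwapStable A B = ∀ {x y} → A x ≡ true → B y ≡ true → 6 ≤ d (χ A) x + a x y + d (χ B) y

  MaxVol : VSubset n → Set
  MaxVol S = ∀ S′ → size S′ ≡ size S → vol (χ S′) ≤ vol (χ S)

  maxVol⇒swapStable : ∀ {A B} → Complementary A B → MaxVol A → SwapStable A B
  maxVol⇒swapStable {A} {B} A⊎B max {x} {y} x∈A y∈B
    with A′ , sw ← swap-exists A x∈A (∈⇒∉ (complementary-sym A⊎B) y∈B) = begin
      6                               ≡⟨ d-split A⊎B y ⟨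
      d (χ A) y + d (χ B) y           ≤⟨ +-monoˡ-≤ (d (χ B) y) (*-cancelˡ-≤ 2 (+-cancelˡ-≤ (vol (χ A)) _ _ (begin
        vol (χ A) + 2 * d (χ A) y               ≡⟨ swapped-vol sw ⟨
        vol (χ A′) + 2 * (d (χ A) x + a x y)    ≤⟨ +-monoˡ-≤ _ (max A′ (swapped-size sw)) ⟩
        vol (χ A) + 2 * (d (χ A) x + a x y)     ∎))) ⟩
      d (χ A) x + a x y + d (χ B) y   ∎

  swapStable-sym : ∀ {A B} → SwapStable A B → SwapStable B A
  swapStable-sym {A} {B} stable {y} {x} y∈B x∈A =
    subst (6 ≤_) (trans (rearrange (d (χ A) x) (a x y) (d (χ B) y)) (cong (λ □ → d (χ B) y + □ + d (χ A) x) (a-sym x y)))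
      (stable x∈A y∈B)
    where
    rearrange : ∀ p q r → p + q + r ≡ r + q + p
    rearrange = solve-∀

  -- Consequences of the absence of an internal partition.

  module NoPartition (¬partition : ¬ HasInternalPartition G) where

    -- A nonempty cohesive subset of `B` would grow together with `A` into an internal partition.
    -- Since low vertices can be searched for, this refutation yields a witness.
    degenerate-outside : ∀ {A B} → Complementary A B → Cohesive A → 1 ≤ size A → Degenerate B
    degenerate-outside {A} {B} A⊎B cohA A≠∅ T T⊆B T≠∅ = decidable-stable (lowDegreeVertex? T) λ ¬low →
      ¬partition (disjoint-cohesive⇒partition n A T (m≤n+m n (size A)) cohA (¬low⇒cohesive T ¬low)
        (λ v v∈T → ∈⇒∉ (complementary-sym A⊎B) (T⊆B v v∈T))
        (nonempty-∈ A A≠∅) (nonempty-∈ T T≠∅))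

    -- The assumption is `SwapStable` rather than `MaxVol` because it survives interchanging the
    -- parts, which `low-outside` does.
    module LowVertex {A B : VSubset n} (A⊎B : Complementary A B) (stable : SwapStable A B) (2≤∣B∣ : 2 ≤ size B)
                     {y} (y∈B : B y ≡ true) (dy≤2 : d (χ B) y ≤ 2) where

      k = d (χ B) y

      k+dy≡6 : k + d (χ A) y ≡ 6
      k+dy≡6 = trans (+-comm k _) (d-split A⊎B y)

      A-cohesive : Cohesive A
      A-cohesive x x∈A = +-cancelʳ-≤ 3 _ _ (begin
        6                        ≤⟨ stable x∈A y∈B ⟩
        d (χ A) x + a x y + k    ≤⟨ +-mono-≤ (+-monoʳ-≤ (d (χ A) x) (⟦⟧≤1 (adj G x y))) dy≤2 ⟩
        d (χ A) x + 1 + 2        ≡⟨ +-assoc (d (χ A) x) 1 2 ⟩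
        d (χ A) x + 3            ∎)

      A-nonempty : 1 ≤ size A
      A-nonempty = ≤-trans (+-cancelˡ-≤ 2 1 _ (begin
        3                      ≤⟨ s≤s (s≤s (s≤s z≤n)) ⟩
        6                      ≡⟨ k+dy≡6 ⟨
        k + d (χ A) y          ≤⟨ +-monoˡ-≤ _ dy≤2 ⟩
        2 + d (χ A) y          ∎)) (d≤size A y)

      B-degenerate : Degenerate B
      B-degenerate = degenerate-outside {A} {B} A⊎B A-cohesive A-nonempty

      vol-B : vol (χ B) + 6 ≤ 4 * size B
      vol-B = degenerate⇒vol (size B ∸ 2) B (sym (m+[n∸m]≡n 2≤∣B∣)) B-degenerate

      -- The two sides of the swap inequality for fixed `y`, set to zero outside `A`. Their sums
      -- give the edge count, and `sum-squeeze` later compares them term by term.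
      lower upper : Fin n → ℕ
      lower x = χ A x * 6
      upper x = χ A x * (d (χ A) x + a x y + k)

      lower≤upper : ∀ x → lower x ≤ upper x
      lower≤upper x = ⟦⟧-*-mono (A x) (λ x∈A → stable x∈A y∈B)

      sum-lower : sum lower ≡ size A * 6
      sum-lower = sym (*-distribʳ-sum 6 (χ A))

      sum-upper : sum upper ≡ vol (χ A) + d (χ A) y + size A * k
      sum-upper = begin-equality
        sum upper
          ≡⟨ sum-cong-≗ (λ x → trans (*-distribˡ-+ (χ A x) (d (χ A) x + a x y) k)
               (cong (_+ χ A x * k) (*-distribˡ-+ (χ A x) (d (χ A) x) (a x y)))) ⟩
        sum (λ x → χ A x * d (χ A) x + χ A x * a x y + χ A x * k)
          ≡⟨ ∑-distrib-+ (λ x → χ A x * d (χ A) x + χ A x * a x y) (λ x → χ A x * k) ⟩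
        sum (λ x → χ A x * d (χ A) x + χ A x * a x y) + sum (λ x → χ A x * k)
          ≡⟨ cong₂ _+_ (∑-distrib-+ (λ x → χ A x * d (χ A) x) (λ x → χ A x * a x y)) (sym (*-distribʳ-sum k (χ A))) ⟩
        vol (χ A) + sum (λ x → χ A x * a x y) + size A * k
          ≡⟨ cong (λ □ → vol (χ A) + □ + size A * k)
               (sum-cong-≗ (λ x → trans (*-comm (χ A x) (a x y)) (cong (_* χ A x) (a-sym x y)))) ⟩
        vol (χ A) + d (χ A) y + size A * k  ∎

      sum-bound : size A * 6 ≤ vol (χ A) + d (χ A) y + size A * k
      sum-bound = subst₂ _≤_ sum-lower sum-upper (sum-mono-≤ lower≤upper)

      -- The swap inequalities give vol A ≥ 4∣A∣ - 4, degeneracy gives vol B ≤ 4∣B∣ - 6, and vol A -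
      -- vol B = 6(∣A∣ - ∣B∣). Together, 2(∣A∣ - ∣B∣) ≥ 2.
      smaller : size B < size A
      smaller = *-cancelˡ-≤ 2 (finish (size A) (size B) (vol (χ A)) (vol (χ B)) vol-bound′ (vol-compl A⊎B) vol-B)
        where
        -- The last hypothesis reads (6 - k)(sA - 1) ≤ vA, and 6 - k is at least 4.
        vol-bound : ∀ k dA sA vA → k ≤ 2 → k + dA ≡ 6 → 1 ≤ sA → sA * 6 ≤ vA + dA + sA * k → 4 * sA ≤ vA + 4
        vol-bound 0 _ sA vA _ refl 1≤sA h = ≤-linear (2 * sA + 2) (+-mono-≤ h (*-monoʳ-≤ 2 1≤sA)) (l sA) (r sA vA)
          where
          l : ∀ sA → sA * 6 + 2 * 1 ≡ 4 * sA + (2 * sA + 2)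
          l = solve-∀
          r : ∀ sA vA → vA + 6 + sA * 0 + 2 * sA ≡ vA + 4 + (2 * sA + 2)
          r = solve-∀
        vol-bound 1 _ sA vA _ refl 1≤sA h = ≤-linear (2 * sA + 1) (+-mono-≤ h 1≤sA) (l sA) (r sA vA)
          where
          l : ∀ sA → sA * 6 + 1 ≡ 4 * sA + (2 * sA + 1)
          l = solve-∀
          r : ∀ sA vA → vA + 5 + sA * 1 + sA ≡ vA + 4 + (2 * sA + 1)
          r = solve-∀
        vol-bound 2 _ sA vA _ refl 1≤sA h = ≤-linear (2 * sA) h (l sA) (r sA vA)
          where
          l : ∀ sA → sA * 6 ≡ 4 * sA + 2 * sA
          l = solve-∀
          r : ∀ sA vA → vA + 4 + sA * 2 ≡ vA + 4 + 2 * sA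
          r = solve-∀
        vol-bound (suc (suc (suc _))) _ _ _ (s≤s (s≤s ()))
        vol-bound′ = vol-bound k (d (χ A) y) (size A) (vol (χ A)) dy≤2 k+dy≡6 A-nonempty sum-bound
        finish : ∀ sA sB vA vB → 4 * sA ≤ vA + 4 → vA + sB * 6 ≡ vB + sA * 6 → vB + 6 ≤ 4 * sB → 2 * suc sB ≤ 2 * sA
        finish sA sB vA vB h₁ h₂ h₃ = ≤-linear (vA + vB + 4 * sA + 4 * sB + 4)
          (+-mono-≤ (+-mono-≤ h₁ (≤-reflexive h₂)) h₃) (l sA sB vA vB) (r sA sB vA vB)
          where
          l : ∀ sA sB vA vB → 4 * sA + (vA + sB * 6) + (vB + 6) ≡ 2 * suc sB + (vA + vB + 4 * sA + 4 * sB + 4)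
          l = solve-∀
          r : ∀ sA sB vA vB → vA + 4 + (vB + sA * 6) + 4 * sB ≡ 2 * sA + (vA + vB + 4 * sA + 4 * sB + 4)
          r = solve-∀

      -- Equality in the edge count when the sizes differ by one.

      module Tight (∣A∣≡ : size A ≡ suc (size B)) where

        2≤∣A∣ : 2 ≤ size A
        2≤∣A∣ = ≤-trans 2≤∣B∣ (<⇒≤ smaller)

        -- Here vol A = vol B + 6 ≤ 4∣B∣ = 4∣A∣ - 4, which meets the lower bound used in `smaller`.
        vol-A : vol (χ A) + 4 ≤ 4 * size A
        vol-A = arith (size A) (size B) (vol (χ A)) (vol (χ B)) ∣A∣≡ (vol-compl A⊎B) vol-B
          where
          arith : ∀ sA sB vA vB → sA ≡ suc sB → vA + sB * 6 ≡ vB + sA * 6 → vB + 6 ≤ 4 * sB → vA + 4 ≤ 4 * sA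
          arith _ sB vA vB refl h₂ h₃ = ≤-linear (vB + 6 * sB + 2) (+-mono-≤ (≤-reflexive h₂) h₃) (l sB vA vB) (r sB vA vB)
            where
            l : ∀ sB vA vB → vA + sB * 6 + (vB + 6) ≡ vA + 4 + (vB + 6 * sB + 2)
            l = solve-∀
            r : ∀ sB vA vB → vB + suc sB * 6 + 4 * sB ≡ 4 * suc sB + (vB + 6 * sB + 2)
            r = solve-∀

        -- For k < 2 the lower bound (6 - k)(∣A∣ - 1) on vol A would exceed 4(∣A∣ - 1), as ∣A∣ ≥ 2.
        d-low : k ≡ 2
        d-low = arith k (d (χ A) y) (size A) (vol (χ A)) dy≤2 k+dy≡6 2≤∣A∣ sum-bound vol-A
          where
          arith : ∀ k dA sA vA → k ≤ 2 → k + dA ≡ 6 → 2 ≤ sA → sA * 6 ≤ vA + dA + sA * k → vA + 4 ≤ 4 * sA → k ≡ 2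
          arith 0 _ sA vA _ refl 2≤sA h h′ = contradiction
            (*-cancelˡ-≤ 2 (≤-linear (sA * 4 + vA + 4) (+-mono-≤ h h′) (l sA vA) (r sA vA))) (<⇒≱ 2≤sA)
            where
            l : ∀ sA vA → sA * 6 + (vA + 4) ≡ 2 * sA + (sA * 4 + vA + 4)
            l = solve-∀
            r : ∀ sA vA → vA + 6 + sA * 0 + 4 * sA ≡ 2 * 1 + (sA * 4 + vA + 4)
            r = solve-∀
          arith 1 _ sA vA _ refl 2≤sA h h′ = contradiction
            (≤-linear (sA * 5 + vA + 4) (+-mono-≤ h h′) (l sA vA) (r sA vA)) (<⇒≱ 2≤sA)
            where
            l : ∀ sA vA → sA * 6 + (vA + 4) ≡ sA + (sA * 5 + vA + 4)
            l = solve-∀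
            r : ∀ sA vA → vA + 5 + sA * 1 + 4 * sA ≡ 1 + (sA * 5 + vA + 4)
            r = solve-∀
          arith 2 _ _ _ _ _ _ _ _ = refl
          arith (suc (suc (suc _))) _ _ _ (s≤s (s≤s ()))

        d-opposite : d (χ A) y ≡ 4
        d-opposite = +-cancelˡ-≡ 2 _ _ (trans (cong (_+ d (χ A) y) (sym d-low)) k+dy≡6)

        upper≤lower : sum upper ≤ sum lower
        upper≤lower = begin
          sum upper                              ≡⟨ sum-upper ⟩
          vol (χ A) + d (χ A) y + size A * k     ≡⟨ cong₂ (λ p q → vol (χ A) + p + size A * q) d-opposite d-low ⟩
          vol (χ A) + 4 + size A * 2             ≤⟨ +-monoˡ-≤ _ vol-A ⟩
          4 * size A + size A * 2                ≡⟨ rearrange (size A) ⟩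
          size A * 6                             ≡⟨ sum-lower ⟨
          sum lower                              ∎
          where
          rearrange : ∀ s → 4 * s + s * 2 ≡ s * 6
          rearrange = solve-∀

        d-A : ∀ {x} → A x ≡ true → d (χ A) x + a x y ≡ 4
        d-A {x} x∈A = +-cancelʳ-≡ 2 _ _ (begin-equality
          d (χ A) x + a x y + 2                 ≡⟨ cong (d (χ A) x + a x y +_) d-low ⟨
          d (χ A) x + a x y + k                 ≡⟨ *-identityˡ _ ⟨
          1 * (d (χ A) x + a x y + k)           ≡⟨ cong (_* (d (χ A) x + a x y + k)) (χ-true A x∈A) ⟨
          upper x                               ≡⟨ sum-squeeze lower≤upper upper≤lower x ⟨
          χ A x * 6                             ≡⟨ cong (_* 6) (χ-true A x∈A) ⟩
          6                                     ∎)

        -- By `d-opposite` and `d-A` both correction terms in `swapped-vol` are 2 · 4, so the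
        -- exchange keeps the volume.
        swapped-maxVol : MaxVol A → ∀ {A′ x} → A x ≡ true → Swapped A A′ x y → MaxVol A′
        swapped-maxVol max {A′} {x} x∈A sw S ∣S∣≡ = ≤-trans (max S (trans ∣S∣≡ (swapped-size sw)))
          (≤-reflexive (+-cancelʳ-≡ (2 * 4) _ _ (begin-equality
            vol (χ A) + 2 * 4                        ≡⟨ cong (λ □ → vol (χ A) + 2 * □) d-opposite ⟨
            vol (χ A) + 2 * d (χ A) y                ≡⟨ swapped-vol sw ⟨
            vol (χ A′) + 2 * (d (χ A) x + a x y)     ≡⟨ cong (λ □ → vol (χ A′) + 2 * □) (d-A x∈A) ⟩
            vol (χ A′) + 2 * 4                       ∎)))

    -- Suppose `B` is cohesive. A low vertex in `S` would force ∣S∣ < ∣B∣ by `smaller` with the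
    -- parts interchanged, so `S` is cohesive too and the two form an internal partition.
    low-outside : ∀ {S B} → Complementary S B → MaxVol S → size B ≤ size S → 2 ≤ size B → LowDegreeVertex B
    low-outside {S} {B} S⊎B max ∣B∣≤∣S∣ 2≤∣B∣ = decidable-stable (lowDegreeVertex? B) λ ¬lowB →
      ¬partition (disjoint-cohesive⇒partition n S B (m≤n+m n (size S))
        (¬low⇒cohesive S λ (x , x∈S , dx≤2) → ≤⇒≯ ∣B∣≤∣S∣
          (LowVertex.smaller B⊎S (swapStable-sym (maxVol⇒swapStable S⊎B max)) 2≤∣S∣ x∈S dx≤2))
        (¬low⇒cohesive B ¬lowB) (λ v → ∈⇒∉ B⊎S)
        (nonempty-∈ S (≤-trans (n≤1+n 1) 2≤∣S∣)) (nonempty-∈ B (≤-trans (n≤1+n 1) 2≤∣B∣)))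
      where
      B⊎S = complementary-sym S⊎B
      2≤∣S∣ = ≤-trans 2≤∣B∣ ∣B∣≤∣S∣

    -- The extremal configuration: exchanges of y and the neighbours of z.

    module Extremal {S B : VSubset n} (S⊎B : Complementary S B) (max : MaxVol S)
                    (∣S∣≡ : size S ≡ suc (size B)) (2≤∣B∣ : 2 ≤ size B) (8≤∣S∣ : 8 ≤ size S)
                    {y} (y∈B : B y ≡ true) (dy≤2 : d (χ B) y ≤ 2)
                    {z} (z∈B-y : remove B y z ≡ true) (dz≤2 : d (χ (remove B y)) z ≤ 2) where

      open LowVertex S⊎B (maxVol⇒swapStable S⊎B max) 2≤∣B∣ y∈B dy≤2
      open Tight ∣S∣≡

      B-y = remove B y

      z∈B : B z ≡ true
      z∈B = remove⊆ B y z z∈B-y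

      y≢z : y ≢ z
      y≢z = remove-≢ B y z z∈B-y

      d-B-z : d (χ B-y) z + a z y ≡ d (χ B) z
      d-B-z = trans (sym (d-⊕δ (χ B-y) y z)) (d-cong (χ-remove B y∈B) z)

      y∉S : S y ≡ false
      y∉S = ∈⇒∉ (complementary-sym S⊎B) y∈B

      -- After exchanging y with a non-neighbour x of z, both x and z have
      -- degree 2 in the smaller part, and tightness pins down the
      -- neighbourhood of either in the larger part.
      module Exchange {x} (x∈S : S x ≡ true) (azx≡0 : a z x ≡ 0) {S′} (sw : Swapped S S′ x y) where

        B′ = compl S′
        S′⊎B′ = compl-complementary S′
        swB : Swapped B B′ y x
        swB = swapped-compl S⊎B S′⊎B′ sw
        x≢y : x ≢ y
        x≢y refl = true≢false (trans (sym x∈S) y∉S)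
        dB′x≡2 : d (χ B′) x ≡ 2
        dB′x≡2 = +-cancelʳ-≡ 4 _ _ (begin-equality
          d (χ B′) x + 4                         ≡⟨ cong (d (χ B′) x +_) (d-A x∈S) ⟨
          d (χ B′) x + (d (χ S) x + a x y)       ≡⟨ rearrange (d (χ B′) x) (d (χ S) x) (a x y) ⟩
          d (χ S) x + (d (χ B′) x + a x y)       ≡⟨ cong (d (χ S) x +_) (swapped-d swB x) ⟩
          d (χ S) x + (d (χ B) x + a x x)        ≡⟨ cong (λ □ → d (χ S) x + (d (χ B) x + □)) (a-irrefl x) ⟩
          d (χ S) x + (d (χ B) x + 0)            ≡⟨ cong (d (χ S) x +_) (+-identityʳ (d (χ B) x)) ⟩
          d (χ S) x + d (χ B) x                  ≡⟨ d-split S⊎B x ⟩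
          6                                      ∎)
          where
          rearrange : ∀ p q r → p + (q + r) ≡ q + (p + r)
          rearrange = solve-∀
        -- Passing from `B` to `B′` removes `y` and adds `x`, which is not adjacent to `z`.
        dB′z : d (χ B′) z ≡ d (χ B-y) z
        dB′z = +-cancelʳ-≡ (a z y) _ _ (begin-equality
          d (χ B′) z + a z y      ≡⟨ swapped-d swB z ⟩
          d (χ B) z + a z x       ≡⟨ cong (d (χ B) z +_) azx≡0 ⟩
          d (χ B) z + 0           ≡⟨ +-identityʳ _ ⟩
          d (χ B) z               ≡⟨ d-B-z ⟨
          d (χ B-y) z + a z y     ∎)
        ∣S′∣≡ : size S′ ≡ suc (size B′)
        ∣S′∣≡ = trans (swapped-size sw) (trans ∣S∣≡ (cong suc (sym (swapped-size swB))))
        module Low {v} (v∈B′ : B′ v ≡ true) (dv≤2 : d (χ B′) v ≤ 2) =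
          LowVertex.Tight S′⊎B′ (maxVol⇒swapStable S′⊎B′ (swapped-maxVol max x∈S sw))
            (subst (2 ≤_) (sym (swapped-size swB)) 2≤∣B∣) v∈B′ dv≤2 ∣S′∣≡
        module Low-x = Low (swapped-new swB (x≢y ∘ sym)) (≤-reflexive dB′x≡2)
        module Low-z = Low (swapped-∈ swB z∈B y≢z) (subst (_≤ 2) (sym dB′z) dz≤2)
        -- Both d(w) + [w ∼ x] and d(w) + [w ∼ z], with degrees taken in `S′`, equal 4 by tightness
        -- at the low vertices `x` and `z`.
        same : ∀ {w} → S′ w ≡ true → a w x ≡ a w z
        same {w} w∈S′ = +-cancelˡ-≡ (d (χ S′) w) _ _ (trans (Low-x.d-A w∈S′) (sym (Low-z.d-A w∈S′)))
        d-S-z : d (χ S) z + a z y ≡ 4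
        d-S-z = +-cancelʳ-≡ 2 _ _ (begin-equality
          d (χ S) z + a z y + 2                  ≡⟨ cong (d (χ S) z + a z y +_) (trans (sym dB′z) Low-z.d-low) ⟨
          d (χ S) z + a z y + d (χ B-y) z        ≡⟨ rearrange (d (χ S) z) (a z y) (d (χ B-y) z) ⟩
          d (χ S) z + (d (χ B-y) z + a z y)      ≡⟨ cong (d (χ S) z +_) d-B-z ⟩
          d (χ S) z + d (χ B) z                  ≡⟨ d-split S⊎B z ⟩
          6                                      ∎)
          where
          rearrange : ∀ p q r → p + q + r ≡ p + (r + q)
          rearrange = solve-∀

      -- The consequences of one exchange, freed of `S′`, whose members are `y` and the vertices of
      -- `S` other than `x`.
      twins : ∀ {x} → S x ≡ true → a z x ≡ 0 →
              d (χ S) z + a z y ≡ 4 × (∀ {w} → S w ≡ true → x ≢ w → a w x ≡ a w z) × a y x ≡ a y z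
      twins x∈S azx≡0 =
        let S′ , sw = swap-exists S x∈S y∉S
            open Exchange x∈S azx≡0 {S′} sw
        in d-S-z , (λ w∈S x≢w → same (swapped-∈ sw w∈S x≢w)) , same (swapped-new sw x≢y)

      X : VSubset n
      X u = S u ∧ not (adj G z u)

      ∣X∣+dz : size X + d (χ S) z ≡ size S
      ∣X∣+dz = trans (sym (∑-distrib-+ (χ X) (λ u → a z u * χ S u))) (sum-cong-≗ split)
        where
        split : ∀ u → χ X u + a z u * χ S u ≡ χ S u
        split u with S u | adj G z u
        ... | true  | true  = refl
        ... | true  | false = refl
        ... | false | true  = refl
        ... | false | false = refl

      X⇒ : ∀ {u} → X u ≡ true → S u ≡ true × a z u ≡ 0
      X⇒ {u} u∈X with S u | adj G z u
      ... | true | false = refl , refl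

      neighbour-in-S : ∀ v → 1 ≤ d (χ S) v → ∃ λ w → S w ≡ true × a v w ≡ 1
      neighbour-in-S v 1≤dv =
        let w , 1≤avw*Sw = sum-positive (λ u → a v u * χ S u) 1≤dv
            avw , w∈S = ⟦⟧*⟦⟧≥1⇒true 1≤avw*Sw
        in w , w∈S , cong ⟦_⟧ avw

      -- By `twins`, each `u` in `X` has the same adjacency to `w` as `z` has; `u` differs from `w`
      -- because only `w` is adjacent to `z`.
      neighbours⊇X : ∀ {w} → S w ≡ true → a z w ≡ 1 → size X ≤ d (χ S) w
      neighbours⊇X {w} w∈S azw≡1 = sum-mono-≤ λ u → bound u (X u) refl
        where
        bound : ∀ u b → X u ≡ b → ⟦ b ⟧ ≤ a w u * χ S u
        bound u false _ = z≤n
        bound u true u∈X =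
          let u∈S , azu≡0 = X⇒ u∈X
              u≢w = λ u≡w → 0≢1+n (trans (sym azu≡0) (trans (cong (a z) u≡w) azw≡1))
          in ≤-reflexive (sym (cong₂ _*_
               (trans (proj₁ (proj₂ (twins u∈S azu≡0)) w∈S u≢w) (trans (a-sym w z) azw≡1)) (χ-true S u∈S)))

      -- At most 6 of the at least 8 vertices of `S` are neighbours of `z`.
      X≠∅ : ∃ λ x → X x ≡ true
      X≠∅ = nonempty-∈ X (+-cancelʳ-≤ 6 _ _ (begin
        7                        ≤⟨ n≤1+n 7 ⟩
        8                        ≤⟨ 8≤∣S∣ ⟩
        size S                   ≡⟨ ∣X∣+dz ⟨
        size X + d (χ S) z       ≤⟨ +-monoʳ-≤ (size X) (m≤m+n _ (d (χ B) z)) ⟩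
        size X + (d (χ S) z + d (χ B) z) ≡⟨ cong (size X +_) (d-split S⊎B z) ⟩
        size X + 6               ∎))

      d-S-z+azy : d (χ S) z + a z y ≡ 4
      d-S-z+azy = let u∈S , azu≡0 = X⇒ (proj₂ X≠∅) in proj₁ (twins u∈S azu≡0)

      dz≤⇒≤∣X∣ : ∀ {m k} → m + k ≡ 8 → d (χ S) z ≡ k → m ≤ size X
      dz≤⇒≤∣X∣ {m} {k} m+k≡8 dz≡k = +-cancelʳ-≤ k _ _ (begin
        m + k                    ≡⟨ m+k≡8 ⟩
        8                        ≤⟨ 8≤∣S∣ ⟩
        size S                   ≡⟨ ∣X∣+dz ⟨
        size X + d (χ S) z       ≡⟨ cong (size X +_) dz≡k ⟩
        size X + k               ∎)

      -- Now `z` has 3 neighbours in `S`, so ∣X∣ ≥ 5, and any of these neighbours has degree at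
      -- least 5 in `S`, against the bound 4 from `d-A`.
      z-adjacent-y : a z y ≡ 1 → ⊥
      z-adjacent-y azy≡1 =
        let dz≡3 : d (χ S) z ≡ 3
            dz≡3 = +-cancelʳ-≡ 1 _ 3 (trans (cong (d (χ S) z +_) (sym azy≡1)) d-S-z+azy)
            w , w∈S , azw≡1 = neighbour-in-S z (≤-trans (m≤m+n 1 2) (≤-reflexive (sym dz≡3)))
        in 1+n≰n {4} (begin
          5                       ≤⟨ dz≤⇒≤∣X∣ {5} {3} refl dz≡3 ⟩
          size X                  ≤⟨ neighbours⊇X w∈S azw≡1 ⟩
          d (χ S) w               ≤⟨ m≤m+n (d (χ S) w) (a w y) ⟩
          d (χ S) w + a w y       ≡⟨ d-A w∈S ⟩
          4                       ∎)

      -- Now ∣X∣ ≥ 4. Let `w` in `S` be a neighbour of `y`. If `w` is not adjacent to `z`, then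
      -- `twins` makes `y` adjacent to `z`; otherwise `w` is adjacent to all of `X` and to `y`,
      -- exceeding the total 4 of `d-A`.
      z-nonadjacent-y : a z y ≡ 0 → ⊥
      z-nonadjacent-y azy≡0 =
        let w , w∈S , ayw≡1 = neighbour-in-S y (≤-trans (m≤m+n 1 3) (≤-reflexive (sym d-opposite)))
        in [ azw≢0 w∈S ayw≡1 , azw≢1 w∈S ayw≡1 ]′ (⟦⟧-cases (adj G z w))
        where
        dz≡4 : d (χ S) z ≡ 4
        dz≡4 = trans (sym (+-identityʳ _)) (trans (cong (d (χ S) z +_) (sym azy≡0)) d-S-z+azy)
        azw≢0 : ∀ {w} → S w ≡ true → a y w ≡ 1 → a z w ≢ 0
        azw≢0 w∈S ayw≡1 azw≡0 = 0≢1+n (trans (sym azy≡0) (trans (a-sym z y)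
          (trans (sym (proj₂ (proj₂ (twins w∈S azw≡0)))) ayw≡1)))
        azw≢1 : ∀ {w} → S w ≡ true → a y w ≡ 1 → a z w ≢ 1
        azw≢1 {w} w∈S ayw≡1 azw≡1 = 1+n≰n {4} (begin
          4 + 1                   ≤⟨ +-mono-≤ (dz≤⇒≤∣X∣ {4} {4} refl dz≡4) (≤-reflexive (sym ayw≡1)) ⟩
          size X + a y w          ≤⟨ +-mono-≤ (neighbours⊇X w∈S azw≡1) (≤-reflexive (a-sym y w)) ⟩
          d (χ S) w + a w y       ≡⟨ d-A w∈S ⟩
          4                       ∎)

      impossible : ⊥
      impossible = [ z-nonadjacent-y , z-adjacent-y ]′ (⟦⟧-cases (adj G z y))

    -- From a balanced optimal set to the contradiction.

    no-maxVol : 14 ≤ n → ∀ {S B} → Complementary S B → size B ≤ size S → size S ≤ suc (size B) → ¬ MaxVol S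
    no-maxVol 14≤n {S} {B} S⊎B ∣B∣≤∣S∣ ∣S∣≤1+∣B∣ max =
      let y , y∈B , dy≤2 = low-outside S⊎B max ∣B∣≤∣S∣ 2≤∣B∣
          open LowVertex S⊎B (maxVol⇒swapStable S⊎B max) 2≤∣B∣ y∈B dy≤2
          ∣S∣≡ = ≤-antisym ∣S∣≤1+∣B∣ smaller
          -- The set `B` without `y` is nonempty since ∣B∣ ≥ 2, so degeneracy of `B` provides a low
          -- vertex in it.
          z , z∈B-y , dz≤2 = B-degenerate (remove B y) (remove⊆ B y)
            (≤-pred (subst (2 ≤_) (size-remove B y∈B) 2≤∣B∣))
      in Extremal.impossible S⊎B max ∣S∣≡ 2≤∣B∣ (8≤ ∣S∣≡) y∈B dy≤2 z∈B-y dz≤2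
      where
      14≤ : 14 ≤ size S + size B
      14≤ = subst (14 ≤_) (sym (size-complementary S⊎B)) 14≤n
      2≤∣B∣ : 2 ≤ size B
      2≤∣B∣ = ≮⇒≥ λ ∣B∣<2 → <⇒≱ {3} (m≤m+n 4 10) (≤-trans 14≤
        (+-mono-≤ (≤-trans ∣S∣≤1+∣B∣ ∣B∣<2) (≤-pred ∣B∣<2)))
      -- Here n = 2∣S∣ - 1, and ∣S∣ ≤ 7 would give n ≤ 13.
      8≤ : size S ≡ suc (size B) → 8 ≤ size S
      8≤ ∣S∣≡ = ≮⇒≥ λ ∣S∣<8 → <⇒≱ {13} ≤-refl (≤-trans 14≤
        (+-mono-≤ (≤-pred ∣S∣<8) (≤-pred (subst (_≤ 7) ∣S∣≡ (≤-pred ∣S∣<8)))))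

    -- Replaces the choice of a maximizer: if no set of size `m` is optimal, each one can be
    -- improved, and `k`, a bound on m² - vol, drops every time until `vol≤size²` is violated.
    no-set-of-size : ∀ m → (∀ S → size S ≡ m → ¬ MaxVol S) →
                     ∀ k S → size S ≡ m → m * m ≤ vol (χ S) + k → ⊥
    no-set-of-size m ¬max k S ∣S∣≡m m²≤ = ¬max S ∣S∣≡m λ S′ ∣S′∣≡∣S∣ → ≮⇒≥ λ vol< → improve k m²≤ S′ (trans ∣S′∣≡∣S∣ ∣S∣≡m) vol<
      where
      improve : ∀ k → m * m ≤ vol (χ S) + k → ∀ S′ → size S′ ≡ m → vol (χ S) < vol (χ S′) → ⊥
      improve zero m²≤ S′ refl vol< = <⇒≱ vol< (≤-trans (vol≤size² S′) (subst (_ ≤_) (+-identityʳ _) m²≤))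
      improve (suc k) m²≤ S′ ∣S′∣≡m vol< = no-set-of-size m ¬max k S′ ∣S′∣≡m
        (≤-trans m²≤ (subst (_≤ vol (χ S′) + k) (sym (+-suc _ k)) (+-monoˡ-≤ k vol<)))

    impossible : 14 ≤ n → ⊥
    impossible 14≤n with S , ∣S∣≡ ← exists-of-size ⌈ n /2⌉ (⌈n/2⌉≤n n) =
      no-set-of-size ⌈ n /2⌉ ¬max (⌈ n /2⌉ * ⌈ n /2⌉) S ∣S∣≡ (m≤n+m _ _)
      where
      ¬max : ∀ T → size T ≡ ⌈ n /2⌉ → ¬ MaxVol T
      ¬max T ∣T∣≡ = no-maxVol 14≤n (compl-complementary T)
        (subst₂ _≤_ (sym ∣compl∣≡) (sym ∣T∣≡) (⌊n/2⌋≤⌈n/2⌉ n))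
        (subst₂ (λ p q → p ≤ suc q) (sym ∣T∣≡) (sym ∣compl∣≡) (⌈n/2⌉≤1+⌊n/2⌋ n))
        where
        ∣compl∣≡ : size (compl T) ≡ ⌊ n /2⌋
        ∣compl∣≡ = +-cancelˡ-≡ ⌈ n /2⌉ _ _ (trans (cong (_+ size (compl T)) (sym ∣T∣≡))
          (trans (size-complementary (compl-complementary T))
            (trans (sym (⌊n/2⌋+⌈n/2⌉≡n n)) (+-comm ⌊ n /2⌋ ⌈ n /2⌉))))

theorem1 : ∀ (n : ℕ) (G : SimpleGraph n) → n ≥ 14 → Regular 6 G
    → HasInternalPartition G
theorem1 n G n≥14 regular = decidable-stable (Degrees.hasInternalPartition? G)
  λ ¬partition → SixRegular.NoPartition.impossible G regular ¬partition n≥14
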